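{- If $G$ is a connected twin-free graph of girth at least $5$ on $n\geq 3$ vertices, then $\gamma_t^{\mathrm{ID}}(G)\leq 3n/4$.
   Context: The girth of a graph is the length of its shortest cycle (infinite for acyclic graphs). A graph is twin-free if it has no two distinct vertices $u,v$ with $N(u)=N(v)$ and no two distinct vertices with $N[u]=N[v]$, where $N(v)$, $N[v]=N(v)\cup\{v\}$ are the open and closed neighbourhoods. For $C\subseteq V(G)$, $I(v)=N[v]\cap C$. A total dominating identifying code is a set $C$ with $I(u)\neq I(v)$ for all distinct vertices $u,v$ and such that every vertex has a neighbour in $C$; $\gamma_t^{\mathrm{ID}}(G)$ is its minimum size. -}

module Defs where

open import Data.Nat using (ℕ; zero; suc; _≤_; _+_)
open import Data.Fin using (Fin; zero; suc; inject₁; fromℕ; _≟_)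
open import Data.Fin.Subset using (Subset)
open import Data.Vec using (lookup)
open import Data.Bool using (Bool; true; false; _∧_; _∨_)
open import Data.Product using (Σ; _×_; ∃)
open import Relation.Nullary using (¬_)
open import Relation.Nullary.Decidable using (⌊_⌋)
open import Relation.Binary.PropositionalEquality using (_≡_; _≢_)
open import Function.Definitions using (Injective)

record Graph (n : ℕ) : Set where
  field
    adj     : Fin n → Fin n → Bool
    irrefl  : ∀ v → adj v v ≡ false
    sym     : ∀ u v → adj u v ≡ adj v u
open Graph public

module _ {n : ℕ} (G : Graph n) where

  closedAdj : Fin n → Fin n → Bool
  closedAdj v u = adj G v u ∨ ⌊ v ≟ u ⌋

  data Walk : Fin n → Fin n → Set where
    here : ∀ {u} → Walk u u
    step : ∀ {u w v} → adj G u w ≡ true → Walk w v → Walk u v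

  Connected : Set
  Connected = ∀ u v → Walk u v

  IsCycle : (m : ℕ) → (Fin (3 + m) → Fin n) → Set
  IsCycle m f =
    Injective _≡_ _≡_ f
    × (∀ (i : Fin (2 + m)) → adj G (f (inject₁ i)) (f (suc i)) ≡ true)
    × adj G (f (fromℕ (2 + m))) (f zero) ≡ true

  -- girth(G) ≥ g : every cycle has length at least g (vacuous for acyclic G)
  GirthAtLeast : ℕ → Set
  GirthAtLeast g = ∀ (m : ℕ) (f : Fin (3 + m) → Fin n) → IsCycle m f → g ≤ 3 + m

  TwinFree : Set
  TwinFree = ∀ u v → u ≢ v →
    ¬ (∀ w → adj G u w ≡ adj G v w) × ¬ (∀ w → closedAdj u w ≡ closedAdj v w)

  I : Subset n → Fin n → Fin n → Bool
  I C v w = closedAdj v w ∧ lookup C w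

  IsTotalDominatingIdentifyingCode : Subset n → Set
  IsTotalDominatingIdentifyingCode C =
    (∀ u v → u ≢ v → ¬ (∀ w → I C u w ≡ I C v w))
    × (∀ v → ∃ λ w → adj G v w ≡ true × lookup C w ≡ true)

{-# OPTIONS --safe #-}
-- Pass to an edge-minimal spanning subgraph H without isolated vertices, without
-- K₂-components and with at most one leaf at every vertex.  By minimality every edge of H has
-- an end that is a leaf, or that has degree two and whose other neighbour is a leaf or carries
-- one.  For every leaf ℓ with support t choose a path on three vertices through t avoiding the
-- leaves; only for a component P₄ the path must use one of its two leaves, and then only the
-- smaller one of them is asked to choose.  The code C is the union of the chosen paths.  It is
-- disjoint from the set L of the leaves that choose, so |C| ≤ 3|L| ≤ 3(n − |C|).  By
-- minimality a non-leaf of H outside C has two neighbours in C, and as G has no cycles of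
-- length 3 and 4, this together with the paths separates all vertices.
module Submission where

open import Defs
open import Data.Bool using (true; false; _∧_; _∨_)
open import Data.Bool.Properties using (∨-zeroʳ; ∧-conicalˡ; ⇔→≡) renaming (_≟_ to _≟ᵇ_)
open import Data.Empty using (⊥; ⊥-elim)
open import Data.Fin using (Fin; zero; suc; _≟_; combine; remQuot; _<_; inject₁)
open import Data.Fin.Patterns using (0F; 1F; 2F; 3F)
open import Data.Fin.Properties using (any?; all?; remQuot-combine; _<?_; <-asym; <-cmp)
open import Data.Fin.Subset using (Subset; ∣_∣; _∈_; _∉_; _⊆_; _∪_; ⁅_⁆; ∁; inside; outside)
open import Data.Fin.Subset.Properties using (_∈?_; x∈⁅x⁆; x∈⁅y⁆⇒x≡y; ∣⁅x⁆∣≡1; p⊆q⇒∣p∣≤∣q∣;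
  p⊂q⇒∣p∣<∣q∣; p⊆p∪q; q⊆p∪q; x∈p∪q⁻; x∉p⇒x∈∁p; ∣∁p∣≡n∸∣p∣; ∣p∣≤n; ∣⊥∣≡0; ∉⊥)
open import Data.Nat using (ℕ; zero; suc; _+_; _∸_; _≤_; _*_; z≤n; s≤s) renaming (_<_ to _<ℕ_)
open import Data.Nat.Properties using (≤-trans; ≤-refl; ≤-reflexive; +-mono-≤; +-monoʳ-≤;
  *-monoʳ-≤; m≤n⇒m≤1+n; +-suc; *-suc; *-distribˡ-+; m+[n∸m]≡n; module ≤-Reasoning)
open import Data.Product using (Σ; ∃; _×_; _,_; proj₁; proj₂; uncurry; ∃-syntax)
open import Data.Sum using (_⊎_; inj₁; inj₂; [_,_])
open import Data.Vec using ([]; _∷_; lookup; tabulate)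
open import Data.Vec.Properties using (lookup⇒[]=; []=⇒lookup; lookup∘tabulate)
open import Function using (_∘_; id; mk⇔)
open import Function.Definitions using (Injective)
open import Relation.Binary using (Rel; tri<; tri≈; tri>; Irreflexive;
  Symmetric) renaming (Decidable to Decidable₂)
open import Relation.Binary.PropositionalEquality as ≡ using (_≡_; _≢_; refl; cong; cong₂; subst;
  trans)
open import Relation.Nullary using (¬_; Dec; yes; no; does; contradiction)
open import Relation.Nullary.Decidable using (_×-dec_; _⊎-dec_; _→-dec_; ¬?; dec-true; dec-false;
  does-⇔; ⌊_⌋; isYes≗does; decidable-stable)
open import Relation.Unary using (Decidable)
open import Level using (0ℓ)
import Data.Vec as Vec

-- Subsets given by decidable predicates, and bounds for unions

does⇒ : ∀ {A : Set} (a? : Dec A) → does a? ≡ true → A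
does⇒ (yes a) _ = a

fromDecidable : ∀ {n} {P : Fin n → Set} → Decidable P → Subset n
fromDecidable P? = tabulate (does ∘ P?)

module _ {n} {P : Fin n → Set} (P? : Decidable P) where

  ∈-fromDecidable⁺ : ∀ {x} → P x → x ∈ fromDecidable P?
  ∈-fromDecidable⁺ {x} px =
    lookup⇒[]= x _ (trans (lookup∘tabulate (does ∘ P?) x) (dec-true (P? x) px))

  ∈-fromDecidable⁻ : ∀ {x} → x ∈ fromDecidable P? → P x
  ∈-fromDecidable⁻ {x} x∈ =
    does⇒ (P? x) (trans (≡.sym (lookup∘tabulate (does ∘ P?) x)) ([]=⇒lookup x∈))

∣p∪q∣≤∣p∣+∣q∣ : ∀ {n} (p q : Subset n) → ∣ p ∪ q ∣ ≤ ∣ p ∣ + ∣ q ∣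
∣p∪q∣≤∣p∣+∣q∣ []            []            = z≤n
∣p∪q∣≤∣p∣+∣q∣ (inside  ∷ p) (inside  ∷ q) =
  s≤s (≤-trans (∣p∪q∣≤∣p∣+∣q∣ p q) (+-monoʳ-≤ ∣ p ∣ (m≤n⇒m≤1+n ≤-refl)))
∣p∪q∣≤∣p∣+∣q∣ (inside  ∷ p) (outside ∷ q) = s≤s (∣p∪q∣≤∣p∣+∣q∣ p q)
∣p∪q∣≤∣p∣+∣q∣ (outside ∷ p) (inside  ∷ q) =
  ≤-trans (s≤s (∣p∪q∣≤∣p∣+∣q∣ p q)) (≤-reflexive (≡.sym (+-suc ∣ p ∣ ∣ q ∣)))
∣p∪q∣≤∣p∣+∣q∣ (outside ∷ p) (outside ∷ q) = ∣p∪q∣≤∣p∣+∣q∣ p q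

-- The sets may depend on the proof of `i ∈ p`, since a path is available only for a vertex known to
-- be a selected leaf.
⋃[_] : ∀ {m n} (p : Subset m) → (∀ i → i ∈ p → Subset n) → Subset n
⋃[ [] ]          f = Data.Fin.Subset.⊥
⋃[ inside ∷ p ]  f = f zero Vec.here ∪ ⋃[ p ] (λ i i∈p → f (suc i) (Vec.there i∈p))
⋃[ outside ∷ p ] f = ⋃[ p ] (λ i i∈p → f (suc i) (Vec.there i∈p))

⊆-⋃ : ∀ {m n} (p : Subset m) (f : ∀ i → i ∈ p → Subset n) →
      ∀ {i} (i∈p : i ∈ p) → f i i∈p ⊆ ⋃[ p ] f
⊆-⋃ (inside ∷ p)  f Vec.here        = p⊆p∪q _
⊆-⋃ (inside ∷ p)  f (Vec.there i∈p) = q⊆p∪q _ _ ∘ ⊆-⋃ p _ i∈p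
⊆-⋃ (outside ∷ p) f (Vec.there i∈p) = ⊆-⋃ p _ i∈p

∈-⋃⁻ : ∀ {m n} (p : Subset m) (f : ∀ i → i ∈ p → Subset n) {x : Fin n} →
       x ∈ ⋃[ p ] f → ∃[ i ] Σ (i ∈ p) λ i∈p → x ∈ f i i∈p
∈-⋃⁻ []            f x∈ = ⊥-elim (∉⊥ x∈)
∈-⋃⁻ (inside ∷ p)  f x∈ with x∈p∪q⁻ (f zero Vec.here) _ x∈
... | inj₁ x∈f = zero , Vec.here , x∈f
... | inj₂ x∈⋃ = let i , i∈p , x∈f = ∈-⋃⁻ p _ x∈⋃ in suc i , Vec.there i∈p , x∈f
∈-⋃⁻ (outside ∷ p) f x∈ = let i , i∈p , x∈f = ∈-⋃⁻ p _ x∈ in suc i , Vec.there i∈p , x∈f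

∣⋃∣≤ : ∀ {m n} k (p : Subset m) (f : ∀ i → i ∈ p → Subset n) →
       (∀ {i} (i∈p : i ∈ p) → ∣ f i i∈p ∣ ≤ k) → ∣ ⋃[ p ] f ∣ ≤ k * ∣ p ∣
∣⋃∣≤ {n = n} k []            f f≤k = ≤-trans (≤-reflexive (∣⊥∣≡0 n)) z≤n
∣⋃∣≤         k (inside ∷ p)  f f≤k = begin
  ∣ f zero Vec.here ∪ ⋃[ p ] _ ∣     ≤⟨ ∣p∪q∣≤∣p∣+∣q∣ (f zero Vec.here) _ ⟩
  ∣ f zero Vec.here ∣ + ∣ ⋃[ p ] _ ∣ ≤⟨ +-mono-≤ (f≤k Vec.here) (∣⋃∣≤ k p _ (f≤k ∘ Vec.there)) ⟩
  k + k * ∣ p ∣                      ≡⟨ *-suc k ∣ p ∣ ⟨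
  k * suc ∣ p ∣                      ∎
  where open ≤-Reasoning
∣⋃∣≤         k (outside ∷ p) f f≤k = ∣⋃∣≤ k p _ (f≤k ∘ Vec.there)

fromRelation : ∀ {n} {R : Rel (Fin n) 0ℓ} → Decidable₂ R → Irreflexive _≡_ R → Symmetric R → Graph n
fromRelation R? R-irrefl R-sym = record
  { adj    = λ u v → does (R? u v)
  ; irrefl = λ v → dec-false (R? v v) (R-irrefl refl)
  ; sym    = λ u v → does-⇔ (mk⇔ R-sym R-sym) (R? u v) (R? v u)
  }

-- Leaf vertices and degree two

module Local {n} (H : Graph n) where

  infix 4 _~_

  _~_ : Rel (Fin n) 0ℓ
  u ~ v = adj H u v ≡ true

  _~?_ : Decidable₂ _~_
  u ~? v = adj H u v ≟ᵇ true

  ~-sym : Symmetric _~_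
  ~-sym {u} {v} u~v = trans (≡.sym (sym H u v)) u~v

  ~⇒≢ : ∀ {u v} → u ~ v → u ≢ v
  ~⇒≢ {u} u~u refl with () ← trans (≡.sym u~u) (irrefl H u)

  Leaf : Rel (Fin n) 0ℓ
  Leaf u t = u ~ t × (∀ w → u ~ w → w ≡ t)

  IsLeaf IsSupport : Fin n → Set
  IsLeaf u    = ∃[ t ] Leaf u t
  IsSupport t = ∃[ u ] Leaf u t

  -- Degree exactly two at the middle argument, written so that consecutive facts spell out a path.
  Between : Fin n → Fin n → Fin n → Set
  Between a v c = a ≢ c × v ~ a × v ~ c × (∀ w → v ~ w → w ≡ a ⊎ w ≡ c)

  leaf? : Decidable₂ Leaf
  leaf? u t = u ~? t ×-dec all? (λ w → u ~? w →-dec w ≟ t)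

  isLeaf? : Decidable IsLeaf
  isLeaf? u = any? (leaf? u)

  between? : ∀ a v c → Dec (Between a v c)
  between? a v c = ¬? (a ≟ c) ×-dec v ~? a ×-dec v ~? c
    ×-dec all? (λ w → v ~? w →-dec (w ≟ a ⊎-dec w ≟ c))

  leaf-functional : ∀ {u s t} → Leaf u s → Leaf u t → s ≡ t
  leaf-functional (u~s , _) (_ , only-t) = only-t _ u~s

  ¬leaf : ∀ {u v w t} → u ~ v → u ~ w → v ≢ w → ¬ Leaf u t
  ¬leaf u~v u~w v≢w (_ , only-t) = v≢w (trans (only-t _ u~v) (≡.sym (only-t _ u~w)))

  between-sym : ∀ {a v c} → Between a v c → Between c v a
  between-sym (a≢c , v~a , v~c , only) =
    a≢c ∘ ≡.sym , v~c , v~a , λ w v~w → [ inj₂ , inj₁ ] (only w v~w)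

  between-other : ∀ {a v c w} → Between a v c → v ~ w → w ≢ a → w ≡ c
  between-other (_ , _ , _ , only) v~w w≢a with only _ v~w
  ... | inj₁ w≡a = contradiction w≡a w≢a
  ... | inj₂ w≡c = w≡c

  between-unique : ∀ {a v c x y} → Between a v c → v ~ x → v ~ y → x ≢ a → y ≢ a → x ≡ y
  between-unique b v~x v~y x≢a y≢a =
    trans (between-other b v~x x≢a) (≡.sym (between-other b v~y y≢a))

  between-functional : ∀ {a v c d} → Between a v c → Between a v d → c ≡ d
  between-functional (a≢c , _ , v~c , _) b = between-other b v~c (a≢c ∘ ≡.sym)

  second-neighbour : ∀ {u v} → u ~ v → ¬ Leaf u v → ∃[ w ] u ~ w × w ≢ v
  second-neighbour {u} {v} u~v ¬l with any? (λ w → u ~? w ×-dec ¬? (w ≟ v))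
  ... | yes found = found
  ... | no  none  = contradiction
    (u~v , λ w u~w → decidable-stable (w ≟ v) (λ w≢v → none (w , u~w , w≢v))) ¬l

  third-neighbour : ∀ {u v w} → u ~ v → u ~ w → v ≢ w → ¬ Between v u w →
                    ∃[ x ] u ~ x × x ≢ v × x ≢ w
  third-neighbour {u} {v} {w} u~v u~w v≢w ¬b
    with any? (λ x → u ~? x ×-dec ¬? (x ≟ v) ×-dec ¬? (x ≟ w))
  ... | yes found = found
  ... | no  none  = contradiction (v≢w , u~v , u~w , only) ¬b
    where
    only : ∀ x → u ~ x → x ≡ v ⊎ x ≡ w
    only x u~x = decidable-stable (x ≟ v ⊎-dec x ≟ w)
      (λ x∉ → none (x , u~x , x∉ ∘ inj₁ , x∉ ∘ inj₂))

  TriangleFree : Set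
  TriangleFree = ∀ {u v w} → u ~ v → v ~ w → ¬ u ~ w

  record Sparse : Set where
    field
      neighbour   : ∀ u → ∃[ v ] u ~ v
      no-K₂       : ∀ {u v} → Leaf u v → ¬ Leaf v u
      leaf-unique : ∀ {u v t} → Leaf u t → Leaf v t → u ≡ v

  -- The obstructions at a to deleting the edge ab within the class of sparse graphs.
  Covers : Rel (Fin n) 0ℓ
  Covers a b = Leaf a b ⊎ ∃[ v ] Between b a v × (Leaf v a ⊎ IsSupport v)

  covers? : Decidable₂ Covers
  covers? a b = leaf? a b ⊎-dec any? (λ v → between? b a v ×-dec
    (leaf? v a ⊎-dec any? (λ u → leaf? u v)))

  -- Edge-minimality as a local condition, the form in which the case analysis around a vertex
  -- outside the code uses it. By `deletion-sparse`, an edge covered from neither end can be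
  -- deleted.
  Minimal : Set
  Minimal = ∀ a b → a ~ b → Covers a b ⊎ Covers b a

  edge? : Decidable (λ e → uncurry _~_ (remQuot {n} n e))
  edge? e = uncurry _~?_ (remQuot {n} n e)

  -- Ordered pairs, so each edge occurs twice; the size only measures the descent.
  edges : Subset (n * n)
  edges = fromDecidable edge?

_≼_ : ∀ {n} → Rel (Graph n) 0ℓ
H ≼ G = ∀ {u v} → u ~ᴴ v → u ~ᴳ v
  where open Local H renaming (_~_ to _~ᴴ_)
        open Local G renaming (_~_ to _~ᴳ_)

-- Deleting an edge

module Deletion {n} (H : Graph n) (a b : Fin n) where
  open Local H

  Kept : Rel (Fin n) 0ℓ
  Kept u v = u ~ v × ¬ (u ≡ a × v ≡ b) × ¬ (u ≡ b × v ≡ a)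

  kept? : Decidable₂ Kept
  kept? u v = u ~? v ×-dec ¬? (u ≟ a ×-dec v ≟ b) ×-dec ¬? (u ≟ b ×-dec v ≟ a)

  deletion : Graph n
  deletion = fromRelation kept? (λ { u≡v (u~v , _) → ~⇒≢ u~v u≡v })
    (λ { (u~v , ¬ab , ¬ba) → ~-sym u~v , (λ { (p , q) → ¬ba (q , p) }) , (λ { (p , q) → ¬ab (q , p) }) })

  module D = Local deletion

  kept⇒~ : ∀ {u v} → Kept u v → u D.~ v
  kept⇒~ {u} {v} = dec-true (kept? u v)

  ~⇒kept : ∀ {u v} → u D.~ v → Kept u v
  ~⇒kept {u} {v} = does⇒ (kept? u v)

  deletion-≼ : deletion ≼ H
  deletion-≼ = proj₁ ∘ ~⇒kept

  ∣edges∣-deletion : a ~ b → ∣ D.edges ∣ <ℕ ∣ edges ∣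
  ∣edges∣-deletion a~b = p⊂q⇒∣p∣<∣q∣
    ( (λ {e} e∈ → ∈-fromDecidable⁺ edge? (deletion-≼ (∈-fromDecidable⁻ D.edge? e∈)))
    , combine a b
    , ∈-fromDecidable⁺ edge? (subst (uncurry _~_) (≡.sym (remQuot-combine a b)) a~b)
    , λ ab∈ → proj₁ (proj₂ (~⇒kept (subst (uncurry D._~_) (remQuot-combine a b)
        (∈-fromDecidable⁻ D.edge? ab∈)))) (refl , refl) )

  keep : ∀ {u v} → u ≢ a → u ≢ b → u ~ v → u D.~ v
  keep u≢a u≢b u~v = kept⇒~ (u~v , u≢a ∘ proj₁ , u≢b ∘ proj₁)

  located : ∀ u → u ≡ a ⊎ u ≡ b ⊎ (u ≢ a × u ≢ b)
  located u with u ≟ a | u ≟ b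
  ... | yes u≡a | _       = inj₁ u≡a
  ... | no  _   | yes u≡b = inj₂ (inj₁ u≡b)
  ... | no  u≢a | no  u≢b = inj₂ (inj₂ (u≢a , u≢b))

  -- Deleting `ab` lowers the degree at `a` and `b` only, by one each. A new leaf is therefore one
  -- of these ends and had degree two before.
  leaf-deletion : a ~ b → ∀ {u t} → D.Leaf u t →
    Leaf u t ⊎ (u ≡ a × Between b a t) ⊎ (u ≡ b × Between a b t)
  leaf-deletion a~b {u} {t} (u~t , only) with located u | ~⇒kept u~t
  ... | inj₁ refl | a~t , ¬ab , _ = inj₂ (inj₁ (refl
    , (λ { refl → ¬ab (refl , refl) }) , a~b , a~t , other))
    where
    other : ∀ w → a ~ w → w ≡ b ⊎ w ≡ t
    other w a~w with w ≟ b
    ... | yes w≡b = inj₁ w≡b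
    ... | no  w≢b = inj₂ (only w (kept⇒~ (a~w , w≢b ∘ proj₂ , ~⇒≢ a~b ∘ proj₁)))
  ... | inj₂ (inj₁ refl) | b~t , _ , ¬ba = inj₂ (inj₂ (refl
    , (λ { refl → ¬ba (refl , refl) }) , ~-sym a~b , b~t , other))
    where
    other : ∀ w → b ~ w → w ≡ a ⊎ w ≡ t
    other w b~w with w ≟ a
    ... | yes w≡a = inj₁ w≡a
    ... | no  w≢a = inj₂ (only w (kept⇒~ (b~w , ~⇒≢ a~b ∘ ≡.sym ∘ proj₁ , w≢a ∘ proj₂)))
  ... | inj₂ (inj₂ (u≢a , u≢b)) | u~t′ , _ =
    inj₁ (u~t′ , λ w u~w → only w (keep u≢a u≢b u~w))

  -- If `a` became isolated, it was a leaf at `b`. If `a` became a leaf in a K₂ with an old leaf, or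
  -- beside an old leaf of the same support, then `Covers a b` held. The same applies to `b`, so
  -- only the cases where both ends change remain.
  deletion-sparse : TriangleFree → Sparse → a ~ b → ¬ Covers a b → ¬ Covers b a → D.Sparse
  deletion-sparse triangle-free sparse a~b ¬ab ¬ba = record
    { neighbour = neighbour′ ; no-K₂ = no-K₂′ ; leaf-unique = leaf-unique′ }
    where
    open Sparse sparse

    neighbour′ : ∀ u → ∃[ v ] u D.~ v
    neighbour′ u with located u
    ... | inj₁ refl =
      let w , a~w , w≢b = second-neighbour a~b (¬ab ∘ inj₁)
      in w , kept⇒~ (a~w , w≢b ∘ proj₂ , ~⇒≢ a~b ∘ proj₁)
    ... | inj₂ (inj₁ refl) =
      let w , b~w , w≢a = second-neighbour (~-sym a~b) (¬ba ∘ inj₁)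
      in w , kept⇒~ (b~w , ~⇒≢ a~b ∘ ≡.sym ∘ proj₁ , w≢a ∘ proj₂)
    ... | inj₂ (inj₂ (u≢a , u≢b)) = let w , u~w = neighbour u in w , keep u≢a u≢b u~w

    no-K₂′ : ∀ {u v} → D.Leaf u v → ¬ D.Leaf v u
    no-K₂′ {u} {v} lu lv with leaf-deletion a~b lu | leaf-deletion a~b lv
    ... | inj₁ lu′                 | inj₁ lv′                 = no-K₂ lu′ lv′
    ... | inj₂ (inj₁ (refl , bt))  | inj₁ lv′                 = ¬ab (inj₂ (v , bt , inj₁ lv′))
    ... | inj₂ (inj₂ (refl , bt))  | inj₁ lv′                 = ¬ba (inj₂ (v , bt , inj₁ lv′))
    ... | inj₁ lu′                 | inj₂ (inj₁ (refl , bt))  = ¬ab (inj₂ (u , bt , inj₁ lu′))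
    ... | inj₁ lu′                 | inj₂ (inj₂ (refl , bt))  = ¬ba (inj₂ (u , bt , inj₁ lu′))
    -- From here on both vertices of the K₂ are among `a` and `b`: either they coincide, or their
    -- edge is the deleted one.
    ... | inj₂ (inj₁ (refl , bt))  | inj₂ (inj₁ (refl , _))   = D.~⇒≢ (proj₁ lu) refl
    ... | inj₂ (inj₁ (refl , bt))  | inj₂ (inj₂ (refl , _))   = proj₁ bt refl
    ... | inj₂ (inj₂ (refl , bt))  | inj₂ (inj₁ (refl , _))   = proj₁ bt refl
    ... | inj₂ (inj₂ (refl , bt))  | inj₂ (inj₂ (refl , _))   = D.~⇒≢ (proj₁ lu) refl

    leaf-unique′ : ∀ {u v t} → D.Leaf u t → D.Leaf v t → u ≡ v
    leaf-unique′ {u} {v} {t} lu lv with leaf-deletion a~b lu | leaf-deletion a~b lv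
    ... | inj₁ lu′                | inj₁ lv′                = leaf-unique lu′ lv′
    ... | inj₂ (inj₁ (refl , bt)) | inj₁ lv′                = contradiction (inj₂ (t , bt , inj₂ (v , lv′))) ¬ab
    ... | inj₂ (inj₂ (refl , bt)) | inj₁ lv′                = contradiction (inj₂ (t , bt , inj₂ (v , lv′))) ¬ba
    ... | inj₁ lu′                | inj₂ (inj₁ (refl , bt)) = contradiction (inj₂ (t , bt , inj₂ (u , lu′))) ¬ab
    ... | inj₁ lu′                | inj₂ (inj₂ (refl , bt)) = contradiction (inj₂ (t , bt , inj₂ (u , lu′))) ¬ba
    ... | inj₂ (inj₁ (refl , _))  | inj₂ (inj₁ (refl , _))  = refl
    ... | inj₂ (inj₂ (refl , _))  | inj₂ (inj₂ (refl , _))  = refl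
    -- If both ends become leaves at the same `t`, then `a`, `b`, `t` form a triangle.
    ... | inj₂ (inj₁ (refl , _ , _ , a~t , _)) | inj₂ (inj₂ (refl , _ , _ , b~t , _)) =
      ⊥-elim (triangle-free a~b b~t a~t)
    ... | inj₂ (inj₂ (refl , _ , _ , b~t , _)) | inj₂ (inj₁ (refl , _ , _ , a~t , _)) =
      ⊥-elim (triangle-free a~b b~t a~t)

-- Descent to an edge-minimal sparse subgraph

module _ {n : ℕ} where
  open Local

  -- The strict bound `k` on the number of edges makes the recursion structural: each round deletes
  -- an edge covered from neither end. Triangle-freeness is inherited by subgraphs and is carried
  -- along for `deletion-sparse`.
  minimal-subgraph-below : ∀ k (H : Graph n) → ∣ edges H ∣ <ℕ k → TriangleFree H → Sparse H →
                           ∃[ K ] K ≼ H × Sparse K × Minimal K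
  minimal-subgraph-below (suc k) H (s≤s ∣H∣≤k) triangle-free sparse
    with any? (λ a → any? (λ b → _~?_ H a b ×-dec ¬? (covers? H a b) ×-dec ¬? (covers? H b a)))
  ... | no none = H , id , sparse , λ a b a~b → decidable-stable (covers? H a b ⊎-dec covers? H b a)
    (λ ¬c → none (a , b , a~b , ¬c ∘ inj₁ , ¬c ∘ inj₂))
  ... | yes (a , b , a~b , ¬ab , ¬ba) =
    let open Deletion H a b
        K , K≼ , K-sparse , K-minimal = minimal-subgraph-below k deletion
          (≤-trans (∣edges∣-deletion a~b) ∣H∣≤k)
          (λ u~v v~w u~w → triangle-free (deletion-≼ u~v) (deletion-≼ v~w) (deletion-≼ u~w))
          (deletion-sparse triangle-free sparse a~b ¬ab ¬ba)
    in K , deletion-≼ ∘ K≼ , K-sparse , K-minimal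

  minimal-subgraph : (H : Graph n) → TriangleFree H → Sparse H → ∃[ K ] K ≼ H × Sparse K × Minimal K
  minimal-subgraph H = minimal-subgraph-below (suc ∣ edges H ∣) H ≤-refl

-- The code of a minimal sparse graph

record Cherry {n} (H : Graph n) : Set where
  constructor cherry
  open Local H
  field
    {end₁ mid end₂} : Fin n
    mid~end₁        : mid ~ end₁
    mid~end₂        : mid ~ end₂
    end₁≢end₂       : end₁ ≢ end₂

  members : Subset n
  members = ⁅ end₁ ⁆ ∪ (⁅ mid ⁆ ∪ ⁅ end₂ ⁆)

  end₁∈ : end₁ ∈ members
  end₁∈ = p⊆p∪q _ (x∈⁅x⁆ _)

  mid∈ : mid ∈ members
  mid∈ = q⊆p∪q _ _ (p⊆p∪q _ (x∈⁅x⁆ _))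

  end₂∈ : end₂ ∈ members
  end₂∈ = q⊆p∪q _ _ (q⊆p∪q _ _ (x∈⁅x⁆ _))

  members-elim : (P : Fin n → Set) → P end₁ → P mid → P end₂ → ∀ {x} → x ∈ members → P x
  members-elim P p₁ p p₂ x∈ with x∈p∪q⁻ ⁅ end₁ ⁆ _ x∈
  ... | inj₁ x∈₁ = subst P (≡.sym (x∈⁅y⁆⇒x≡y end₁ x∈₁)) p₁
  ... | inj₂ x∈′ with x∈p∪q⁻ ⁅ mid ⁆ _ x∈′
  ... | inj₁ x∈m = subst P (≡.sym (x∈⁅y⁆⇒x≡y mid x∈m)) p
  ... | inj₂ x∈₂ = subst P (≡.sym (x∈⁅y⁆⇒x≡y end₂ x∈₂)) p₂

  ∣members∣≤3 : ∣ members ∣ ≤ 3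
  ∣members∣≤3 = ≤-trans (∣p∪q∣≤∣p∣+∣q∣ ⁅ end₁ ⁆ _) (+-mono-≤ (≤-reflexive (∣⁅x⁆∣≡1 end₁))
    (≤-trans (∣p∪q∣≤∣p∣+∣q∣ ⁅ mid ⁆ _)
      (+-mono-≤ (≤-reflexive (∣⁅x⁆∣≡1 mid)) (≤-reflexive (∣⁅x⁆∣≡1 end₂)))))

-- Here `m` stands for the size of the code and `l` for the number of selected leaves. One copy of
-- `m` is bounded by the paths, three copies by disjointness from these leaves.
4*m≤3*n : ∀ {m l n} → m ≤ 3 * l → m ≤ n ∸ l → l ≤ n → 4 * m ≤ 3 * n
4*m≤3*n {m} {l} {n} m≤3l m≤n∸l l≤n = begin
  m + 3 * m           ≤⟨ +-mono-≤ m≤3l (*-monoʳ-≤ 3 m≤n∸l) ⟩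
  3 * l + 3 * (n ∸ l) ≡⟨ *-distribˡ-+ 3 l (n ∸ l) ⟨
  3 * (l + (n ∸ l))   ≡⟨ cong (3 *_) (m+[n∸m]≡n l≤n) ⟩
  3 * n               ∎
  where open ≤-Reasoning

module MinimalCode {n} (H : Graph n)
  (sparse : Local.Sparse H) (minimal : Local.Minimal H) where
  open Local H
  open Sparse sparse

  -- The degrees along the path are one, two, two, one, so the four vertices are a whole component.
  P₄ : (ℓ t h m : Fin n) → Set
  P₄ ℓ t h m = Leaf ℓ t × Between ℓ t h × Between t h m × Leaf m h

  P₄-sym : ∀ {ℓ t h m} → P₄ ℓ t h m → P₄ m h t ℓ
  P₄-sym (lℓ , bt , bh , lm) = lm , between-sym bh , between-sym bt , lℓ

  P₄-functional : ∀ {ℓ t h m t′ h′ m′} → P₄ ℓ t h m → P₄ ℓ t′ h′ m′ → t ≡ t′ × m ≡ m′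
  P₄-functional (lℓ , bt , bh , _) (lℓ′ , bt′ , bh′ , _)
    with refl ← leaf-functional lℓ lℓ′ with refl ← between-functional bt bt′ =
    refl , between-functional bh bh′

  -- In `wide` the path is centred at the support `t`; its ends are not leaves because `ℓ` is the
  -- only leaf at `t`. In `long` it starts at `t`, which has degree two, and moves away from `ℓ` to
  -- a non-leaf. In `p₄` the opposite leaf cannot be avoided.
  data Route (ℓ : Fin n) : Set where
    wide : ∀ {t x y} → Leaf ℓ t → t ~ x → t ~ y → x ≢ ℓ → y ≢ ℓ → x ≢ y → Route ℓ
    long : ∀ {t h x} → Leaf ℓ t → Between ℓ t h → h ~ x → x ≢ t → ¬ IsLeaf x → Route ℓ
    p₄   : ∀ {t h m} → P₄ ℓ t h m → Route ℓ

  -- The support has a second neighbour `h` because there is no K₂ component. The cases ask whether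
  -- it has a third one and, if not, whether `h` leads on to a non-leaf.
  route : ∀ {ℓ} → IsLeaf ℓ → Route ℓ
  route {ℓ} (t , lℓ@(ℓ~t , _)) with second-neighbour (~-sym ℓ~t) (no-K₂ lℓ)
  ... | h , t~h , h≢ℓ with between? ℓ t h
  ... | no ¬b = let x , t~x , x≢ℓ , x≢h = third-neighbour (~-sym ℓ~t) t~h (h≢ℓ ∘ ≡.sym) ¬b
                in wide lℓ t~x t~h x≢ℓ h≢ℓ x≢h
  ... | yes bt with any? (λ x → h ~? x ×-dec ¬? (x ≟ t) ×-dec ¬? (isLeaf? x))
  ... | yes (x , h~x , x≢t , ¬lx) = long lℓ bt h~x x≢t ¬lx
  -- A leaf `h` would be a second leaf at `t`.
  ... | no none with second-neighbour (~-sym t~h) (λ lh → h≢ℓ (leaf-unique lh lℓ))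
  ... | m , h~m , m≢t = p₄ (lℓ , bt , bh , leaf-at-h h~m m≢t)
    where
    leaf-at-h : ∀ {x} → h ~ x → x ≢ t → Leaf x h
    leaf-at-h {x} h~x x≢t with isLeaf? x
    ... | no ¬lx = contradiction (x , h~x , x≢t , ¬lx) none
    ... | yes (s , lx@(_ , only-s)) = subst (Leaf x) (≡.sym (only-s h (~-sym h~x))) lx
    -- All neighbours of `h` other than `t` are leaves at `h`, hence there is just one.
    bh : Between t h m
    bh = m≢t ∘ ≡.sym , ~-sym t~h , h~m , only
      where
      only : ∀ w → h ~ w → w ≡ t ⊎ w ≡ m
      only w h~w with w ≟ t
      ... | yes w≡t = inj₁ w≡t
      ... | no  w≢t = inj₂ (leaf-unique (leaf-at-h h~w w≢t) (leaf-at-h h~m m≢t))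

  path : ∀ {ℓ} → Route ℓ → Cherry H
  path (wide _ t~x t~y _ _ x≢y)                 = cherry t~x t~y x≢y
  path (long _ (_ , _ , t~h , _) h~x x≢t _)     = cherry (~-sym t~h) h~x (x≢t ∘ ≡.sym)
  path (p₄ (_ , _ , (t≢m , h~t , h~m , _) , _)) = cherry h~t h~m t≢m

  vertices : ∀ {ℓ} → Route ℓ → Subset n
  vertices r = Cherry.members (path r)

  -- Holds at the larger of the two leaves of a P₄ component, which is the one that does not choose.
  SmallerEnd : Fin n → Set
  SmallerEnd ℓ = ∃[ m ] m < ℓ × ∃[ t ] ∃[ h ] P₄ ℓ t h m

  smallerEnd? : Decidable SmallerEnd
  smallerEnd? ℓ = any? λ m → m <? ℓ ×-dec any? λ t → any? λ h →
    leaf? ℓ t ×-dec between? ℓ t h ×-dec between? t h m ×-dec leaf? m h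

  Selected : Fin n → Set
  Selected ℓ = IsLeaf ℓ × ¬ SmallerEnd ℓ

  selected? : Decidable Selected
  selected? ℓ = isLeaf? ℓ ×-dec ¬? (smallerEnd? ℓ)

  selection : Subset n
  selection = fromDecidable selected?

  selectedRoute : ∀ {ℓ} → ℓ ∈ selection → Route ℓ
  selectedRoute ℓ∈ = route (proj₁ (∈-fromDecidable⁻ selected? ℓ∈))

  chosen : ∀ ℓ → ℓ ∈ selection → Subset n
  chosen _ ℓ∈ = vertices (selectedRoute ℓ∈)

  -- Abstract, since `with` would otherwise normalise the union (very slow).
  abstract
    code : Subset n
    code = ⋃[ selection ] chosen

    selected⇒⊆code : ∀ {ℓ} → Selected ℓ → ∃[ r ] vertices {ℓ} r ⊆ code
    selected⇒⊆code sℓ =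
      let ℓ∈ = ∈-fromDecidable⁺ selected? sℓ in selectedRoute ℓ∈ , ⊆-⋃ selection chosen ℓ∈

    -- The origin `ℓ` serves the counting; the inclusion of the whole path serves domination and
    -- separation.
    code-elim : ∀ {x} → x ∈ code → ∃[ ℓ ] Selected ℓ × Σ (Route ℓ) λ r → x ∈ vertices r × vertices r ⊆ code
    code-elim x∈ =
      let ℓ , ℓ∈ , x∈r = ∈-⋃⁻ selection chosen x∈
      in ℓ , ∈-fromDecidable⁻ selected? ℓ∈ , selectedRoute ℓ∈ , x∈r , ⊆-⋃ selection chosen ℓ∈

    ∣code∣≤3∣selection∣ : ∣ code ∣ ≤ 3 * ∣ selection ∣
    ∣code∣≤3∣selection∣ = ∣⋃∣≤ 3 selection chosen (λ ℓ∈ → Cherry.∣members∣≤3 (path (selectedRoute ℓ∈)))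

  -- Apart from the far end of a `p₄` path, no vertex of a route is a leaf. That far end is the
  -- other leaf of the component, and only the smaller of the two is selected.
  selected⇒∉vertices : ∀ {ℓ x} → Selected ℓ → (r : Route ℓ) → x ∈ vertices r → ¬ Selected x
  selected⇒∉vertices {ℓ} _ r@(wide {t} {x} {y} lℓ@(ℓ~t , _) t~x t~y x≢ℓ y≢ℓ x≢y) =
    Cherry.members-elim (path r) (¬_ ∘ Selected)
      (λ { ((_ , lx) , _) → not-leaf t~x x≢ℓ lx })
      (λ { ((_ , lt) , _) → ¬leaf t~x t~y x≢y lt })
      (λ { ((_ , ly) , _) → not-leaf t~y y≢ℓ ly })
    where
    not-leaf : ∀ {z s} → t ~ z → z ≢ ℓ → ¬ Leaf z s
    not-leaf t~z z≢ℓ lz@(_ , only-s) with refl ← only-s t (~-sym t~z) = z≢ℓ (leaf-unique lz lℓ)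
  selected⇒∉vertices _ r@(long _ (ℓ≢h , t~ℓ , t~h , _) h~x x≢t ¬lx) =
    Cherry.members-elim (path r) (¬_ ∘ Selected)
      (λ { ((_ , lt) , _) → ¬leaf t~ℓ t~h ℓ≢h lt })
      (λ { ((_ , lh) , _) → ¬leaf h~x (~-sym t~h) x≢t lh })
      (λ { (lx , _) → ¬lx lx })
  selected⇒∉vertices {ℓ} (_ , ℓ-first) r@(p₄ {t} {h} {m} p@((_ , ℓ-only) , (ℓ≢h , t~ℓ , t~h , _) , (t≢m , h~t , h~m , _) , _)) =
    Cherry.members-elim (path r) (¬_ ∘ Selected)
      (λ { ((_ , lt) , _) → ¬leaf t~ℓ t~h ℓ≢h lt })
      (λ { ((_ , lh) , _) → ¬leaf h~t h~m t≢m lh })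
      (λ { (_ , m-first) → not-both-first m-first })
    where
    not-both-first : ¬ ¬ SmallerEnd m
    not-both-first m-first with <-cmp ℓ m
    ... | tri< ℓ<m _ _  = m-first (ℓ , ℓ<m , h , t , P₄-sym p)
    -- If the two ends coincided, the leaf would have both `t` and `h` as neighbours.
    ... | tri≈ _ refl _ = ~⇒≢ t~h (≡.sym (ℓ-only h (~-sym h~m)))
    ... | tri> _ _ m<ℓ  = ℓ-first (m , m<ℓ , t , h , p)

  -- Vertices forced into the code

  P₄⇒∈vertices : ∀ {ℓ t h m} → P₄ ℓ t h m → (r : Route ℓ) → t ∈ vertices r × h ∈ vertices r
  P₄⇒∈vertices (lℓ , bt , _) (wide lℓ′ t~x t~y x≢ℓ y≢ℓ x≢y)
    with refl ← leaf-functional lℓ lℓ′ =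
    contradiction (between-unique bt t~x t~y x≢ℓ y≢ℓ) x≢y
  P₄⇒∈vertices (lℓ , bt , bh , lm) (long lℓ′ bt′ h~x x≢t ¬lx)
    with refl ← leaf-functional lℓ lℓ′ with refl ← between-functional bt bt′
    with refl ← between-other bh h~x x≢t = contradiction (_ , lm) ¬lx
  P₄⇒∈vertices (lℓ , bt , _) r@(p₄ (lℓ′ , bt′ , _))
    with refl ← leaf-functional lℓ lℓ′ with refl ← between-functional bt bt′ =
    Cherry.end₁∈ (path r) , Cherry.mid∈ (path r)

  -- The other end of the component is determined by `ℓ` and smaller, so it has no smaller end
  -- opposite to it and is selected.
  ¬selected⇒P₄ : ∀ {ℓ} → IsLeaf ℓ → ¬ Selected ℓ → ∃[ m ] Selected m × ∃[ t ] ∃[ h ] P₄ ℓ t h m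
  ¬selected⇒P₄ {ℓ} lℓ ¬sℓ with smallerEnd? ℓ
  ... | no ¬m = contradiction (lℓ , ¬m) ¬sℓ
  ... | yes (m , m<ℓ , t , h , p@(_ , _ , _ , lm)) = m , ((h , lm) , m-first) , t , h , p
    where
    m-first : ¬ SmallerEnd m
    m-first (k , k<m , _ , _ , q) with _ , refl ← P₄-functional (P₄-sym p) q = <-asym k<m m<ℓ

  P₄⇒∈code : ∀ {ℓ t h m} → P₄ ℓ t h m → t ∈ code × h ∈ code
  P₄⇒∈code {ℓ} p with selected? ℓ
  ... | yes sℓ = let r , r⊆ = selected⇒⊆code sℓ ; t∈ , h∈ = P₄⇒∈vertices p r in r⊆ t∈ , r⊆ h∈
  ... | no ¬sℓ with m , sm , t , h , p′ ← ¬selected⇒P₄ (_ , proj₁ p) ¬sℓ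
    with refl , refl ← P₄-functional p p′ =
    let r , r⊆ = selected⇒⊆code sm ; h∈ , t∈ = P₄⇒∈vertices (P₄-sym p) r in r⊆ t∈ , r⊆ h∈

  -- Every route of `ℓ` passes through its support; for an unselected leaf the opposite leaf's path
  -- contains both inner vertices of the P₄.
  support∈code : ∀ {ℓ t} → Leaf ℓ t → t ∈ code
  support∈code {ℓ} {t} lℓ with selected? ℓ
  ... | no ¬sℓ with _ , _ , _ , _ , p ← ¬selected⇒P₄ (_ , lℓ) ¬sℓ
    with refl ← leaf-functional lℓ (proj₁ p) = proj₁ (P₄⇒∈code p)
  support∈code {ℓ} {t} lℓ | yes sℓ with r , r⊆ ← selected⇒⊆code sℓ = r⊆ (t∈ r)
    where
    t∈ : (r : Route ℓ) → t ∈ vertices r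
    t∈ r@(wide lℓ′ _ _ _ _ _) with refl ← leaf-functional lℓ lℓ′ = Cherry.mid∈ (path r)
    t∈ r@(long lℓ′ _ _ _ _)   with refl ← leaf-functional lℓ lℓ′ = Cherry.end₁∈ (path r)
    t∈ r@(p₄ (lℓ′ , _))       with refl ← leaf-functional lℓ lℓ′ = Cherry.end₁∈ (path r)

  -- A support of degree two rules out `wide`, and the other routes continue through `h`.
  code-distance₂ : ∀ {ℓ t h} → Leaf ℓ t → Between ℓ t h → h ∈ code
  code-distance₂ {ℓ} {t} {h} lℓ bt with selected? ℓ
  ... | no ¬sℓ with _ , _ , _ , _ , p ← ¬selected⇒P₄ (_ , lℓ) ¬sℓ
    with refl ← leaf-functional lℓ (proj₁ p)
    with refl ← between-functional bt (proj₁ (proj₂ p)) = proj₂ (P₄⇒∈code p)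
  code-distance₂ {ℓ} {t} {h} lℓ bt | yes sℓ with r , r⊆ ← selected⇒⊆code sℓ = r⊆ (h∈ r)
    where
    h∈ : (r : Route ℓ) → h ∈ vertices r
    h∈ (wide lℓ′ t~x t~y x≢ℓ y≢ℓ x≢y) with refl ← leaf-functional lℓ lℓ′ =
      contradiction (between-unique bt t~x t~y x≢ℓ y≢ℓ) x≢y
    h∈ r@(long lℓ′ bt′ _ _ _) with refl ← leaf-functional lℓ lℓ′
      with refl ← between-functional bt bt′ = Cherry.mid∈ (path r)
    h∈ r@(p₄ (lℓ′ , bt′ , _)) with refl ← leaf-functional lℓ lℓ′
      with refl ← between-functional bt bt′ = Cherry.mid∈ (path r)

  -- With `t` and `h` both of degree two, the path has no choice but to end at `x`.
  code-distance₃ : ∀ {ℓ t h x} → Leaf ℓ t → Between ℓ t h → Between t h x → ¬ IsLeaf x → x ∈ code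
  code-distance₃ {ℓ} {t} {h} {x} lℓ bt bh ¬lx with selected? ℓ
  ... | no ¬sℓ with _ , _ , _ , _ , p ← ¬selected⇒P₄ (_ , lℓ) ¬sℓ
    with refl ← leaf-functional lℓ (proj₁ p)
    with refl ← between-functional bt (proj₁ (proj₂ p))
    with refl ← between-functional bh (proj₁ (proj₂ (proj₂ p))) =
    contradiction (_ , proj₂ (proj₂ (proj₂ p))) ¬lx
  code-distance₃ {ℓ} {t} {h} {x} lℓ bt bh ¬lx | yes sℓ with r , r⊆ ← selected⇒⊆code sℓ = r⊆ (x∈ r)
    where
    x∈ : (r : Route ℓ) → x ∈ vertices r
    x∈ (wide lℓ′ t~y t~z y≢ℓ z≢ℓ y≢z) with refl ← leaf-functional lℓ lℓ′ =
      contradiction (between-unique bt t~y t~z y≢ℓ z≢ℓ) y≢z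
    x∈ r@(long lℓ′ bt′ h~y y≢t _) with refl ← leaf-functional lℓ lℓ′
      with refl ← between-functional bt bt′
      with refl ← between-other bh h~y y≢t = Cherry.end₂∈ (path r)
    x∈ r@(p₄ (lℓ′ , bt′ , bh′ , _)) with refl ← leaf-functional lℓ lℓ′
      with refl ← between-functional bt bt′
      with refl ← between-functional bh bh′ = Cherry.end₂∈ (path r)

  -- Minimality at the edge `xy` either yields a leaf at `y` at once or leads to a support one step
  -- further on. Minimality at the next edge then again gives a leaf at `y`, or puts `x` on a chain
  -- of degree-two vertices from a leaf, which forces `x` into the code. Throughout, `x` is not a
  -- support, as supports are in the code.
  neighbour-is-support : ∀ {x y} → x ∉ code → ¬ IsLeaf x → x ~ y → IsSupport y
  neighbour-is-support {x} {y} x∉ ¬lx x~y = [ covered-by-x , covered-by-y ] (minimal x y x~y)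
    where
    ¬support : ∀ {ℓ} → ¬ Leaf ℓ x
    ¬support = x∉ ∘ support∈code

    covered-by-y : Covers y x → IsSupport y
    covered-by-y (inj₁ ly) = ⊥-elim (¬support ly)
    covered-by-y (inj₂ (v , _ , inj₁ lv)) = v , lv
    covered-by-y (inj₂ (v , by@(x≢v , y~x , y~v , _) , inj₂ (u , lu@(u~v , u-only)))) =
      [ (λ { (inj₁ ly) → contradiction (proj₂ ly x y~x) x≢v
           ; (inj₂ (w , bw , l)) → via-w (between-functional (between-sym by) bw) l })
      , (λ { (inj₁ lv) → v , lv
           ; (inj₂ (w , bv , _)) → ⊥-elim (x∉ (far bv)) })
      ] (minimal y v y~v)
      where
      via-w : ∀ {w} → x ≡ w → Leaf w y ⊎ IsSupport w → IsSupport y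
      via-w refl (inj₁ lx)       = contradiction (y , lx) ¬lx
      via-w refl (inj₂ (k , lk)) = ⊥-elim (¬support lk)
      u≢y : u ≢ y
      u≢y refl = x≢v (u-only x y~x)
      -- Now `v` has degree two as well, so `x` is the third vertex after the leaf `u`.
      far : ∀ {w} → Between y v w → x ∈ code
      far bv with refl ← between-other bv (~-sym u~v) u≢y =
        code-distance₃ lu (between-sym bv) (between-sym by) ¬lx

    covered-by-x : Covers x y → IsSupport y
    covered-by-x (inj₁ lx) = contradiction (y , lx) ¬lx
    covered-by-x (inj₂ (z , _ , inj₁ lz)) = ⊥-elim (¬support lz)
    covered-by-x (inj₂ (z , bx@(y≢z , _ , x~z , _) , inj₂ (u , lu@(u~z , _)))) =
      [ (λ { (inj₁ lx) → contradiction (z , lx) ¬lx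
           ; (inj₂ (w , bw , l)) → via-w (between-functional (between-sym bx) bw) l })
      , (λ { (inj₁ lz) → ⊥-elim (¬support lz)
           ; (inj₂ (w , bz , _)) → ⊥-elim (x∉ (near bz)) })
      ] (minimal x z x~z)
      where
      via-w : ∀ {w} → y ≡ w → Leaf w x ⊎ IsSupport w → IsSupport y
      via-w refl (inj₁ ly) = ⊥-elim (¬support ly)
      via-w refl (inj₂ sy) = sy
      -- Now `z` has degree two, so `x` is the second vertex after the leaf `u`.
      near : ∀ {w} → Between x z w → x ∈ code
      near bz with refl ← between-other bz (~-sym u~z) (λ { refl → ¬lx (_ , lu) }) =
        code-distance₂ lu (between-sym bz)

  two-code-neighbours : ∀ {x} → x ∉ code → ¬ IsLeaf x →
    ∃[ y ] ∃[ z ] y ≢ z × (x ~ y × y ∈ code) × (x ~ z × z ∈ code)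
  two-code-neighbours {x} x∉ ¬lx =
    let y , x~y = neighbour x
        z , x~z , z≢y = second-neighbour x~y (λ lx → ¬lx (y , lx))
        _ , ly = neighbour-is-support x∉ ¬lx x~y
        _ , lz = neighbour-is-support x∉ ¬lx x~z
    in y , z , z≢y ∘ ≡.sym , (x~y , support∈code ly) , (x~z , support∈code lz)

  code-cherry : ∀ {x} → x ∈ code → Σ (Cherry H) λ c → x ∈ Cherry.members c × Cherry.members c ⊆ code
  code-cherry x∈ = let _ , _ , r , x∈r , r⊆ = code-elim x∈ in path r , x∈r , r⊆

  4∣code∣≤3n : 4 * ∣ code ∣ ≤ 3 * n
  4∣code∣≤3n = 4*m≤3*n
    ∣code∣≤3∣selection∣
    (≤-trans (p⊆q⇒∣p∣≤∣q∣ code⊆∁selection) (≤-reflexive (∣∁p∣≡n∸∣p∣ selection)))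
    (∣p∣≤n selection)
    where
    code⊆∁selection : code ⊆ ∁ selection
    code⊆∁selection x∈ = let ℓ , sℓ , r , x∈r , _ = code-elim x∈ in
      x∉p⇒x∈∁p (selected⇒∉vertices sℓ r x∈r ∘ ∈-fromDecidable⁻ selected?)

-- Girth at least five

injective-from-< : ∀ {m} {A : Set} {f : Fin m → A} → (∀ i j → i < j → f i ≢ f j) → Injective _≡_ _≡_ f
injective-from-< f-< {i} {j} fi≡fj with <-cmp i j
... | tri< i<j _ _ = contradiction fi≡fj (f-< i j i<j)
... | tri≈ _ i≡j _ = i≡j
... | tri> _ _ j<i = contradiction (≡.sym fi≡fj) (f-< j i j<i)

module Girth₅ {n} (G : Graph n) (girth : GirthAtLeast G 5) where
  open Local G

  triangle-free : TriangleFree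
  triangle-free {u} {v} {w} u~v v~w u~w =
    too-short (girth 0 f (injective-from-< f-< , f-adjacent , ~-sym u~w))
    where
    too-short : ¬ 5 ≤ 3
    too-short (s≤s (s≤s (s≤s ())))
    f : Fin 3 → Fin n
    f 0F = u
    f 1F = v
    f 2F = w
    f-< : ∀ i j → i < j → f i ≢ f j
    f-< 0F 1F _ = ~⇒≢ u~v
    f-< 0F 2F _ = ~⇒≢ u~w
    f-< 1F 2F _ = ~⇒≢ v~w
    f-< 1F 1F (s≤s ())
    f-< 2F 1F (s≤s ())
    f-< 2F 2F (s≤s (s≤s ()))
    f-adjacent : ∀ (i : Fin 2) → f (inject₁ i) ~ f (suc i)
    f-adjacent 0F = u~v
    f-adjacent 1F = v~w

  no-4-cycle : ∀ {u v w x} → u ~ v → v ~ w → w ~ x → x ~ u → u ≢ w → v ≢ x → ⊥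
  no-4-cycle {u} {v} {w} {x} u~v v~w w~x x~u u≢w v≢x =
    -- A cycle with parameter `m` has `3 + m` vertices, so 1 encodes length four. Consecutive
    -- vertices differ by adjacency, opposite ones by assumption.
    too-short (girth 1 f (injective-from-< f-< , f-adjacent , x~u))
    where
    too-short : ¬ 5 ≤ 4
    too-short (s≤s (s≤s (s≤s (s≤s ()))))
    f : Fin 4 → Fin n
    f 0F = u
    f 1F = v
    f 2F = w
    f 3F = x
    f-< : ∀ i j → i < j → f i ≢ f j
    f-< 0F 1F _ = ~⇒≢ u~v
    f-< 0F 2F _ = u≢w
    f-< 0F 3F _ = ~⇒≢ x~u ∘ ≡.sym
    f-< 1F 2F _ = ~⇒≢ v~w
    f-< 1F 3F _ = v≢x
    f-< 2F 3F _ = ~⇒≢ w~x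
    f-< 1F 1F (s≤s ())
    f-< 2F 1F (s≤s ())
    f-< 2F 2F (s≤s (s≤s ()))
    f-< 3F 1F (s≤s ())
    f-< 3F 2F (s≤s (s≤s ()))
    f-< 3F 3F (s≤s (s≤s (s≤s ())))
    f-adjacent : ∀ (i : Fin 3) → f (inject₁ i) ~ f (suc i)
    f-adjacent 0F = u~v
    f-adjacent 1F = v~w
    f-adjacent 2F = w~x

-- Closed neighbourhoods, and sparseness from twin-freeness

∃-distinct : ∀ {n} → 2 ≤ n → (u : Fin n) → ∃[ v ] u ≢ v
∃-distinct (s≤s (s≤s _)) zero    = suc zero , λ ()
∃-distinct (s≤s (s≤s _)) (suc u) = zero , λ ()

module _ {n} (G : Graph n) where
  open Local G

  closedAdj⁺ : ∀ {u v} → u ~ v ⊎ u ≡ v → closedAdj G u v ≡ true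
  closedAdj⁺ {u} {v} (inj₁ u~v) = cong (_∨ ⌊ u ≟ v ⌋) u~v
  closedAdj⁺ {u}     (inj₂ refl) =
    trans (cong (adj G u u ∨_) (trans (isYes≗does (u ≟ u)) (dec-true (u ≟ u) refl))) (∨-zeroʳ _)

  closedAdj⁻ : ∀ {u v} → closedAdj G u v ≡ true → u ~ v ⊎ u ≡ v
  closedAdj⁻ {u} {v} p with adj G u v | u ≟ v
  ... | true  | _       = inj₁ refl
  ... | false | yes u≡v = inj₂ u≡v

  I⁺ : ∀ {C u v} → u ~ v ⊎ u ≡ v → v ∈ C → I G C u v ≡ true
  I⁺ u≃v v∈C = cong₂ _∧_ (closedAdj⁺ u≃v) ([]=⇒lookup v∈C)

  I⁻ : ∀ {C u v} → I G C u v ≡ true → u ~ v ⊎ u ≡ v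
  I⁻ {C} {u} {v} p = closedAdj⁻ (∧-conicalˡ (closedAdj G u v) (lookup C v) p)

  -- Two leaves with one support are open twins, and the ends of a K₂ component are closed twins. A
  -- neighbour comes from the first step of a walk to a different vertex.
  twin-free⇒sparse : 2 ≤ n → Connected G → TwinFree G → Sparse
  twin-free⇒sparse 2≤n connected twin-free = record
    { neighbour = λ u → let v , u≢v = ∃-distinct 2≤n u in first-step (connected u v) u≢v
    ; no-K₂ = λ lu lv → proj₂ (twin-free _ _ (~⇒≢ (proj₁ lu)))
        (λ w → ⇔→≡ (mk⇔ (same-closed lu lv w) (same-closed lv lu w)))
    ; leaf-unique = λ {u} {v} lu lv → decidable-stable (u ≟ v) (λ u≢v →
        proj₁ (twin-free u v u≢v) (λ w → ⇔→≡ (mk⇔ (same-open lu lv w) (same-open lv lu w))))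
    }
    where
    first-step : ∀ {u v} → Walk G u v → u ≢ v → ∃[ w ] u ~ w
    first-step here         u≢u = contradiction refl u≢u
    first-step (step u~w _) _   = _ , u~w

    same-open : ∀ {u v t} → Leaf u t → Leaf v t → ∀ w → u ~ w → v ~ w
    same-open (_ , u-only) (v~t , _) w u~w with refl ← u-only w u~w = v~t

    same-closed : ∀ {u v} → Leaf u v → Leaf v u → ∀ w → closedAdj G u w ≡ true → closedAdj G v w ≡ true
    same-closed (u~v , u-only) _ w p with closedAdj⁻ p
    ... | inj₁ u~w  = closedAdj⁺ (inj₂ (≡.sym (u-only w u~w)))
    ... | inj₂ refl = closedAdj⁺ (inj₁ (~-sym u~v))

-- Domination and separation in `G` by the code of `H`

module _ {n} {G H : Graph n} (girth : GirthAtLeast G 5) (H≼G : H ≼ G)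
  (sparse : Local.Sparse H) (minimal : Local.Minimal H) where
  open Local G using (_~_; ~-sym)
  open Local H using (Leaf; isLeaf?) renaming (_~_ to _~ᴴ_; ~⇒≢ to ~ᴴ⇒≢)
  open Local.Sparse sparse using (leaf-unique)
  open MinimalCode H sparse minimal
  open Girth₅ G girth

  -- The path through `x` offers a vertex next to `x`. If `x` is the middle, one of the two ends
  -- differs from `y`; if `x` is an end and `y` the middle, the opposite end is adjacent to `y`.
  third-in-code : ∀ {x} y → x ∈ code → x ≢ y →
    ∃[ w ] w ∈ code × w ≢ x × w ≢ y × (x ~ w ⊎ y ~ w)
  third-in-code {x} y x∈ with c@(cherry {a} {b} {d} b~a b~d a≢d) , x∈c , c⊆ ← code-cherry x∈ =
    Cherry.members-elim c Third (end (b~a , c⊆ (Cherry.end₁∈ c)) (b~d , c⊆ (Cherry.end₂∈ c)) a≢d)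
      mid′ (end (b~d , c⊆ (Cherry.end₂∈ c)) (b~a , c⊆ (Cherry.end₁∈ c)) (a≢d ∘ ≡.sym)) x∈c
    where
    Third : Fin n → Set
    Third x = x ≢ y → ∃[ w ] w ∈ code × w ≢ x × w ≢ y × (x ~ w ⊎ y ~ w)
    end : ∀ {p q} → b ~ᴴ p × p ∈ code → b ~ᴴ q × q ∈ code → p ≢ q → Third p
    end {p} {q} (b~p , _) (b~q , q∈) p≢q _ with b ≟ y
    ... | yes refl = q , q∈ , p≢q ∘ ≡.sym , ~ᴴ⇒≢ b~q ∘ ≡.sym , inj₂ (H≼G b~q)
    ... | no  b≢y  = b , c⊆ (Cherry.mid∈ c) , ~ᴴ⇒≢ b~p , b≢y , inj₁ (~-sym (H≼G b~p))
    mid′ : Third b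
    mid′ _ with a ≟ y
    ... | yes refl = d , c⊆ (Cherry.end₂∈ c) , ~ᴴ⇒≢ b~d ∘ ≡.sym , a≢d ∘ ≡.sym , inj₁ (H≼G b~d)
    ... | no  a≢y  = a , c⊆ (Cherry.end₁∈ c) , ~ᴴ⇒≢ b~a ∘ ≡.sym , a≢y , inj₁ (H≼G b~a)

  code-neighbour : ∀ v → ∃[ w ] v ~ w × w ∈ code
  code-neighbour v with v ∈? code | isLeaf? v
  ... | no v∉ | no ¬lv = let y , _ , _ , (v~y , y∈) , _ = two-code-neighbours v∉ ¬lv in y , H≼G v~y , y∈
  ... | _     | yes (t , lv@(v~t , _)) = t , H≼G v~t , support∈code lv
  ... | yes v∈ | no _ with c@(cherry {a} {b} {d} b~a b~d a≢d) , v∈c , c⊆ ← code-cherry v∈ =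
    Cherry.members-elim c (λ v → ∃[ w ] v ~ w × w ∈ code)
      (b , ~-sym (H≼G b~a) , c⊆ (Cherry.mid∈ c))
      (a , H≼G b~a , c⊆ (Cherry.end₁∈ c))
      (b , ~-sym (H≼G b~d) , c⊆ (Cherry.mid∈ c)) v∈c

  SameI : Fin n → Fin n → Set
  SameI u v = ∀ w → I G code u w ≡ I G code v w

  SameI-sym : ∀ {u v} → SameI u v → SameI v u
  SameI-sym same w = ≡.sym (same w)

  transfer : ∀ {u v w} → SameI u v → w ∈ code → u ~ w ⊎ u ≡ w → v ≢ w → v ~ w
  transfer {w = w} same w∈ u≃w v≢w with I⁻ G {code} (trans (≡.sym (same w)) (I⁺ G u≃w w∈))
  ... | inj₁ v~w = v~w
  ... | inj₂ v≡w = contradiction v≡w v≢w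

  -- Equal sets make `u` and `v` adjacent, and the third code vertex next to one of them is then
  -- next to both, closing a triangle.
  separates-code : ∀ {u v} → u ≢ v → u ∈ code → ¬ SameI u v
  separates-code {u} {v} u≢v u∈ same with third-in-code v u∈ u≢v
  ... | w , w∈ , w≢u , w≢v , inj₁ u~w =
    triangle-free (transfer same u∈ (inj₂ refl) (u≢v ∘ ≡.sym)) u~w
      (transfer same w∈ (inj₁ u~w) (w≢v ∘ ≡.sym))
  ... | w , w∈ , w≢u , w≢v , inj₂ v~w =
    triangle-free (transfer same u∈ (inj₂ refl) (u≢v ∘ ≡.sym))
      (transfer (SameI-sym same) w∈ (inj₁ v~w) (w≢u ∘ ≡.sym)) v~w

  -- The two code neighbours of `u` would also be neighbours of `v`, closing a 4-cycle.
  separates-non-leaf : ∀ {u v} → u ≢ v → u ∉ code → v ∉ code → ¬ Local.IsLeaf H u → ¬ SameI u v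
  separates-non-leaf u≢v u∉ v∉ ¬lu same
    with y , z , y≢z , (u~y , y∈) , (u~z , z∈) ← two-code-neighbours u∉ ¬lu =
    no-4-cycle (H≼G u~y) (~-sym (transfer same y∈ (inj₁ (H≼G u~y)) λ { refl → v∉ y∈ }))
      (transfer same z∈ (inj₁ (H≼G u~z)) λ { refl → v∉ z∈ }) (~-sym (H≼G u~z)) u≢v y≢z

  -- The supports differ and are in the code, so each would be adjacent in `G` to both leaves,
  -- closing a 4-cycle.
  separates-leaves : ∀ {u v s t} → u ≢ v → u ∉ code → v ∉ code → Leaf u s → Leaf v t → ¬ SameI u v
  separates-leaves {s = s} {t} u≢v u∉ v∉ lu@(u~s , _) lv@(v~t , _) same with s ≟ t
  ... | yes refl = u≢v (leaf-unique lu lv)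
  ... | no s≢t   = no-4-cycle (H≼G u~s)
    (~-sym (transfer same s∈ (inj₁ (H≼G u~s)) λ { refl → v∉ s∈ })) (H≼G v~t)
    (~-sym (transfer (SameI-sym same) t∈ (inj₁ (H≼G v~t)) λ { refl → u∉ t∈ })) u≢v s≢t
    where
    s∈ = support∈code lu
    t∈ = support∈code lv

  separates : ∀ u v → u ≢ v → ¬ SameI u v
  separates u v u≢v same with u ∈? code | v ∈? code | isLeaf? u | isLeaf? v
  ... | yes u∈ | _      | _            | _            = separates-code u≢v u∈ same
  ... | no _   | yes v∈ | _            | _            = separates-code (u≢v ∘ ≡.sym) v∈ (SameI-sym same)
  ... | no u∉  | no v∉  | no ¬lu       | _            = separates-non-leaf u≢v u∉ v∉ ¬lu same
  ... | no u∉  | no v∉  | yes _        | no ¬lv       = separates-non-leaf (u≢v ∘ ≡.sym) v∉ u∉ ¬lv (SameI-sym same)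
  ... | no u∉  | no v∉  | yes (_ , lu) | yes (_ , lv) = separates-leaves u≢v u∉ v∉ lu lv same

  code-total-dominating-identifying : IsTotalDominatingIdentifyingCode G code
  code-total-dominating-identifying = separates ,
    λ v → let w , v~w , w∈ = code-neighbour v in w , v~w , []=⇒lookup w∈

theorem13 : ∀ {n : ℕ} (G : Graph n) → 3 ≤ n → Connected G → TwinFree G → GirthAtLeast G 5 →
    ∃ λ (C : Subset n) → IsTotalDominatingIdentifyingCode G C × 4 * ∣ C ∣ ≤ 3 * n
theorem13 G 3≤n connected twin-free girth =
  let H , H≼G , sparse , minimal = minimal-subgraph G (Girth₅.triangle-free G girth)
        (twin-free⇒sparse G (≤-trans (s≤s (s≤s z≤n)) 3≤n) connected twin-free)
      open MinimalCode H sparse minimal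
  in code , code-total-dominating-identifying {G = G} girth H≼G sparse minimal , 4∣code∣≤3n
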